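{- Let $j\ge 4$ be an integer, and write $\rho_i=\rho_i(F_j,2)$ for the residue of $F_i^2$ modulo $F_j$ with $0\le\rho_i\le F_j-1$. (i) If $j=2t$ is even, then the sequence $\mathcal{F}^2(F_j)=(F_i^2 \bmod F_j: i\ge 0)$ has periodicity $j$ and the values of $\rho_i$ for $i\in\{0,\ldots,j-1\}$ are (i.1) $\rho_i=F_i^2$ if $i\in\{0,\ldots,t\}$; (i.2) $\rho_i=F_{j-i}^2$ if $i\in\{t+1,\ldots,j-1\}$. (ii) If $j=2t+1$ is odd, then $\mathcal{F}^2(F_j)$ has periodicity $2j$ and the values of $\rho_i$ for $i\in\{0,\ldots,2j-1\}$ are (ii.1) $\rho_i=F_i^2$ if $i\in\{0,\ldots,t+1\}$; (ii.2) $\rho_i=F_j-F_{j-i}^2$ if $i\in\{t+2,\ldots,j-1\}$; (ii.3) $\rho_i=0$ if $i=j$; (ii.4) $\rho_i=\rho_{2j-i}$ if $i\in\{j+1,\ldots,2j-1\}$.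
   Context: The Fibonacci numbers are $F_0=0$, $F_1=1$, $F_{i+1}=F_i+F_{i-1}$ for $i\ge 1$. For integers $j\ge 1$, $e\ge 1$, $\rho_i(F_j,e)$ is the integer with $\rho_i(F_j,e)\equiv F_i^e\pmod{F_j}$ and $0\le\rho_i(F_j,e)\le F_j-1$, and $\mathcal{F}^e(F_j)$ denotes the sequence $(F_i^e \bmod F_j: i\ge 0)$. A sequence $(a_i:i\ge 0)$ is periodic if there is an integer $p\ge 1$, called a period, with $a_{i+p}=a_i$ for all $i\ge 0$; its periodicity is its minimum period. -}

module Defs where

open import Data.Nat using (ℕ; zero; suc; _+_; _*_; _^_; _%_; _≤_; _>_; NonZero; >-nonZero; z≤n; s≤s)
open import Data.Nat.Properties using (≤-trans; m≤m+n)
open import Data.Product using (_×_)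
open import Relation.Binary.PropositionalEquality using (_≡_)

F : ℕ → ℕ
F zero          = 0
F (suc zero)    = 1
F (suc (suc n)) = F (suc n) + F n

F-suc>0 : ∀ n → F (suc n) > 0
F-suc>0 zero    = s≤s z≤n
F-suc>0 (suc n) = ≤-trans (F-suc>0 n) (m≤m+n (F (suc n)) (F n))

F-nonZero : ∀ j .{{_ : NonZero j}} → NonZero (F j)
F-nonZero (suc n) = >-nonZero (F-suc>0 n)

-- ρ i j e is the paper's ρ_i(F_j, e); it depends on the index j, not on the
-- modulus F j directly, so that the modulus is known to be nonzero.
ρ : (i j e : ℕ) .{{_ : NonZero j}} → ℕ
ρ i j e = _%_ (F i ^ e) (F j) {{F-nonZero j}}

𝓕 : (e j : ℕ) .{{_ : NonZero j}} → ℕ → ℕ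
𝓕 e j i = ρ i j e

IsPeriod : (ℕ → ℕ) → ℕ → Set
IsPeriod a p = 1 ≤ p × (∀ i → a (i + p) ≡ a i)

HasPeriodicity : (ℕ → ℕ) → ℕ → Set
HasPeriodicity a p = IsPeriod a p × (∀ q → IsPeriod a q → p ≤ q)

{-# OPTIONS --safe #-}
-- Catalan's identity F(b+d)² − (−1)ᵈ F(b)² = F(2b+d) F(d) drives everything.
-- Reading it modulo F(2b+d) gives the reflection F(a)² ≡ (−1)ʲ F(j−a)² modulo
-- F(j), and reading it modulo F(d) gives the translation F(i+j)² ≡ (−1)ʲ F(i)².
-- As F(i)² < F(j) for i ≤ t (j = 2t) or i ≤ t+1 (j = 2t+1), these congruences
-- determine all residues.  A period q has ρ_q = ρ₀ = 0, and the residues vanish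
-- only at multiples of j; for odd j, q = j is excluded because
-- ρ_{j+1} = F(j) − 1 ≠ 1 = ρ₁.
module Submission where

open import Data.Nat using (ℕ; zero; suc; _+_; _*_; _∸_; _^_; _%_; _≤_; _<_; NonZero; z≤n; s≤s; s≤s⁻¹)
open import Data.Nat.Properties
open import Data.Nat.Divisibility using (_∣_; divides; m∣m*n; n∣m⇒m%n≡0)
open import Data.Nat.DivMod using (m<n⇒m%n≡m; [m+kn]%n≡m%n)
open import Data.Nat.Solver using (module +-*-Solver)
open import Data.Nat.Tactic.RingSolver using (solve-∀)
open import Data.Integer using (+_; _-_)
import Data.Integer.Properties as ℤ
open import Data.Product using (_×_; _,_)
open import Data.Sum using (inj₁; inj₂)
open import Relation.Nullary using (yes; no; contradiction)
open import Relation.Binary using (tri<; tri≈; tri>)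
open import Relation.Binary.PropositionalEquality
open import Defs

open +-*-Solver using (solve; con; _:+_; _:*_; _:^_; _:=_)

-- The signs of the Fibonacci identities are carried by even d and even (suc d),
-- the positive and the negative part of (−1)ᵈ, so that no subtraction occurs.
even : ℕ → ℕ
even zero          = 1
even (suc zero)    = 0
even (suc (suc n)) = even n

-- The index `b + (b + d)` is the larger one in Catalan's identity; sharing the parity of `d`, it
-- lets a sign known for the modulus be used for `d`.
even-double : ∀ b d → even (b + (b + d)) ≡ even d
even-double zero    d = refl
even-double (suc b) d rewrite +-suc b (b + d) = even-double b d

even-suc-double : ∀ b d → even (suc (b + (b + d))) ≡ even (suc d)
even-suc-double b d = trans (cong even (eq b d)) (even-double b (suc d))
  where
  eq : ∀ b d → suc (b + (b + d)) ≡ b + (b + suc d)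
  eq = solve-∀

even-2* : ∀ t → even (2 * t) ≡ 1
even-2* t = even-double t 0

even-1+2* : ∀ t → even (suc (2 * t)) ≡ 0
even-1+2* t = even-suc-double t 0

-- Addition formula and the identities of Cassini and Catalan

F-+-suc : ∀ m n → F (m + suc n) ≡ F (suc m) * F (suc n) + F m * F n
F-+-suc zero    n = eq (F (suc n))
  where
  eq : ∀ x → x ≡ 1 * x + 0
  eq = solve-∀
F-+-suc (suc m) n = begin
  F (suc m + suc n)                               ≡⟨ cong F (+-suc m (suc n)) ⟨
  F (m + suc (suc n))                             ≡⟨ F-+-suc m (suc n) ⟩
  F (suc m) * F (suc (suc n)) + F m * F (suc n)   ≡⟨ eq (F (suc m)) (F m) (F (suc n)) (F n) ⟩
  F (suc (suc m)) * F (suc n) + F (suc m) * F n   ∎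
  where
  open ≡-Reasoning
  eq : ∀ y x q p → y * (q + p) + x * q ≡ (y + x) * q + y * p
  eq = solve-∀

-- Cassini's identity with F(d+2) expanded and the sign split over both sides. The induction step
-- adds the same terms to both sides and swaps the two sign parts.
cassini : ∀ d → F (suc d) ^ 2 + even (suc d) ≡ F d ^ 2 + F (suc d) * F d + even d
cassini zero    = refl
cassini (suc d) = begin
  (p + r) ^ 2 + even d                     ≡⟨ lhs p r (even d) ⟩
  p ^ 2 + p * r + (r ^ 2 + p * r + even d) ≡⟨ cong (λ z → p ^ 2 + p * r + z) (cassini d) ⟨
  p ^ 2 + p * r + (p ^ 2 + even (suc d))   ≡⟨ rhs p r (even (suc d)) ⟩
  p ^ 2 + (p + r) * p + even (suc d)       ∎
  where
  open ≡-Reasoning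
  p = F (suc d)
  r = F d
  lhs : ∀ p r e → (p + r) ^ 2 + e ≡ p ^ 2 + p * r + (r ^ 2 + p * r + e)
  lhs = solve 3 (λ p r e → (p :+ r) :^ 2 :+ e := p :^ 2 :+ p :* r :+ (r :^ 2 :+ p :* r :+ e)) refl
  rhs : ∀ p r e → p ^ 2 + p * r + (p ^ 2 + e) ≡ p ^ 2 + (p + r) * p + e
  rhs = solve 3 (λ p r e → p :^ 2 :+ p :* r :+ (p :^ 2 :+ e) := p :^ 2 :+ (p :+ r) :* p :+ e) refl

-- No induction: from index 2 on, the addition formula turns both sides into polynomials in four
-- Fibonacci numbers, and they differ only by Cassini's identity multiplied by F(b)².
catalan : ∀ b d →
  F (b + d) ^ 2 + even (suc d) * F b ^ 2 ≡ even d * F b ^ 2 + F (b + (b + d)) * F d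
catalan b zero rewrite +-identityʳ b = eq (F b) (F (b + b))
  where
  eq : ∀ x g → x ^ 2 + 0 * x ^ 2 ≡ 1 * x ^ 2 + g * 0
  eq = solve 2 (λ x g → x :^ 2 :+ con 0 :* x :^ 2 := con 1 :* x :^ 2 :+ g :* con 0) refl
catalan b (suc zero) rewrite +-comm b 1 | F-+-suc b b = eq (F (suc b)) (F b)
  where
  eq : ∀ y x → y ^ 2 + 1 * x ^ 2 ≡ 0 * x ^ 2 + (y * y + x * x) * 1
  eq = solve 2 (λ y x →
    y :^ 2 :+ con 1 :* x :^ 2
    := con 0 :* x :^ 2 :+ (y :* y :+ x :* x) :* con 1) refl
catalan b (suc (suc d))
  -- The successor is moved outward to expand F(2b+d+2), then back inward to expand F(b+d+2) and
  -- F(b+d+1).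
  rewrite +-suc b (suc d) | F-+-suc b (b + suc d) | sym (+-suc b (suc d))
        | F-+-suc b (suc d) | F-+-suc b d = begin
  (y * (p + r) + x * p) ^ 2 + even (suc d) * x ^ 2
    ≡⟨ lhs y x p r (even (suc d)) ⟩
  y ^ 2 * (p + r) ^ 2 + 2 * x * y * p * (p + r) + x ^ 2 * (p ^ 2 + even (suc d))
    ≡⟨ cong (λ z → y ^ 2 * (p + r) ^ 2 + 2 * x * y * p * (p + r) + x ^ 2 * z) (cassini d) ⟩
  y ^ 2 * (p + r) ^ 2 + 2 * x * y * p * (p + r) + x ^ 2 * (r ^ 2 + p * r + even d)
    ≡⟨ rhs y x p r (even d) ⟩
  even d * x ^ 2 + (y * (y * (p + r) + x * p) + x * (y * p + x * r)) * (p + r) ∎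
  where
  open ≡-Reasoning
  y = F (suc b)
  x = F b
  p = F (suc d)
  r = F d
  lhs : ∀ y x p r e → (y * (p + r) + x * p) ^ 2 + e * x ^ 2
    ≡ y ^ 2 * (p + r) ^ 2 + 2 * x * y * p * (p + r) + x ^ 2 * (p ^ 2 + e)
  lhs = solve 5 (λ y x p r e →
    (y :* (p :+ r) :+ x :* p) :^ 2 :+ e :* x :^ 2
    := y :^ 2 :* (p :+ r) :^ 2 :+ con 2 :* x :* y :* p :* (p :+ r) :+ x :^ 2 :* (p :^ 2 :+ e)) refl
  rhs : ∀ y x p r e →
    y ^ 2 * (p + r) ^ 2 + 2 * x * y * p * (p + r) + x ^ 2 * (r ^ 2 + p * r + e)
    ≡ e * x ^ 2 + (y * (y * (p + r) + x * p) + x * (y * p + x * r)) * (p + r)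
  rhs = solve 5 (λ y x p r e →
    y :^ 2 :* (p :+ r) :^ 2 :+ con 2 :* x :* y :* p :* (p :+ r) :+ x :^ 2 :* (r :^ 2 :+ p :* r :+ e)
    := e :* x :^ 2 :+ (y :* (y :* (p :+ r) :+ x :* p) :+ x :* (y :* p :+ x :* r)) :* (p :+ r)) refl

catalan-even : ∀ b d → even d ≡ 1 → even (suc d) ≡ 0 →
  F (b + d) ^ 2 ≡ F b ^ 2 + F (b + (b + d)) * F d
catalan-even b d e o = begin
  F (b + d) ^ 2                                   ≡⟨ +-identityʳ _ ⟨
  F (b + d) ^ 2 + 0 * F b ^ 2                     ≡⟨ cong (λ z → F (b + d) ^ 2 + z * F b ^ 2) o ⟨
  F (b + d) ^ 2 + even (suc d) * F b ^ 2          ≡⟨ catalan b d ⟩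
  even d * F b ^ 2 + F (b + (b + d)) * F d        ≡⟨ cong (λ z → z * F b ^ 2 + F (b + (b + d)) * F d) e ⟩
  1 * F b ^ 2 + F (b + (b + d)) * F d             ≡⟨ cong (_+ F (b + (b + d)) * F d) (*-identityˡ (F b ^ 2)) ⟩
  F b ^ 2 + F (b + (b + d)) * F d                 ∎
  where open ≡-Reasoning

catalan-odd : ∀ b d → even d ≡ 0 → even (suc d) ≡ 1 →
  F (b + d) ^ 2 + F b ^ 2 ≡ F (b + (b + d)) * F d
catalan-odd b d e o = begin
  F (b + d) ^ 2 + F b ^ 2                         ≡⟨ cong (λ z → F (b + d) ^ 2 + z) (*-identityˡ (F b ^ 2)) ⟨
  F (b + d) ^ 2 + 1 * F b ^ 2                     ≡⟨ cong (λ z → F (b + d) ^ 2 + z * F b ^ 2) o ⟨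
  F (b + d) ^ 2 + even (suc d) * F b ^ 2          ≡⟨ catalan b d ⟩
  even d * F b ^ 2 + F (b + (b + d)) * F d        ≡⟨ cong (λ z → z * F b ^ 2 + F (b + (b + d)) * F d) e ⟩
  F (b + (b + d)) * F d                           ∎
  where open ≡-Reasoning

-- Translation and reflection modulo F(j)

ρ-translate-even : ∀ i j .{{_ : NonZero j}} → even j ≡ 1 → even (suc j) ≡ 0 →
  ρ (i + j) j 2 ≡ ρ i j 2
ρ-translate-even i j e o rewrite catalan-even i j e o =
  [m+kn]%n≡m%n (F i ^ 2) (F (i + (i + j))) (F j) {{F-nonZero j}}

-- The indices `b` and `b + d` sum to the modulus index, so here the other factor of Catalan's
-- product is the modulus.
ρ-reflect-even : ∀ b d .{{_ : NonZero (b + (b + d))}} →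
  even (b + (b + d)) ≡ 1 → even (suc (b + (b + d))) ≡ 0 →
  ρ (b + d) (b + (b + d)) 2 ≡ ρ b (b + (b + d)) 2
ρ-reflect-even b d e o
  rewrite catalan-even b d (trans (sym (even-double b d)) e) (trans (sym (even-suc-double b d)) o)
        | *-comm (F (b + (b + d))) (F d) =
  [m+kn]%n≡m%n (F b ^ 2) (F d) (F (b + (b + d))) {{F-nonZero (b + (b + d))}}

-- The congruence carries a minus sign here; as divisibility of a sum it stays within ℕ.
F∣translate-odd : ∀ i j → even j ≡ 0 → even (suc j) ≡ 1 → F j ∣ F (i + j) ^ 2 + F i ^ 2
F∣translate-odd i j e o = divides (F (i + (i + j))) (catalan-odd i j e o)

F∣reflect-odd-≤ : ∀ b a → b ≤ a → even (b + a) ≡ 0 → even (suc (b + a)) ≡ 1 →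
  F (b + a) ∣ F a ^ 2 + F b ^ 2
F∣reflect-odd-≤ b a b≤a e o with a ∸ b | m+[n∸m]≡n b≤a
... | d | refl = divides (F d) (trans
  (catalan-odd b d (trans (sym (even-double b d)) e) (trans (sym (even-suc-double b d)) o))
  (*-comm (F (b + (b + d))) (F d)))

F∣reflect-odd : ∀ b a → even (b + a) ≡ 0 → even (suc (b + a)) ≡ 1 →
  F (b + a) ∣ F a ^ 2 + F b ^ 2
F∣reflect-odd b a e o with ≤-total b a
... | inj₁ b≤a = F∣reflect-odd-≤ b a b≤a e o
... | inj₂ a≤b = subst₂ (λ j s → F j ∣ s) (+-comm a b) (+-comm (F b ^ 2) (F a ^ 2))
  (F∣reflect-odd-≤ a b a≤b (trans (cong even (+-comm a b)) e)
                           (trans (cong (λ j → even (suc j)) (+-comm a b)) o))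

-- Residues of negatives

-- Both numbers represent -y. Since x + (x′ + y) = x′ + (x + y) with both brackets multiples of n,
-- no subtraction is required.
%-cong-negation : ∀ {x x′ y} n .{{_ : NonZero n}} → n ∣ x + y → n ∣ x′ + y → x % n ≡ x′ % n
%-cong-negation {x} {x′} {y} n (divides k eq) (divides k′ eq′) = begin
  x % n             ≡⟨ [m+kn]%n≡m%n x k′ n ⟨
  (x + k′ * n) % n  ≡⟨ cong (λ z → (x + z) % n) eq′ ⟨
  (x + (x′ + y)) % n ≡⟨ cong (_% n) (swap x x′ y) ⟩
  (x′ + (x + y)) % n ≡⟨ cong (λ z → (x′ + z) % n) eq ⟩
  (x′ + k * n) % n  ≡⟨ [m+kn]%n≡m%n x′ k n ⟩
  x′ % n            ∎
  where
  open ≡-Reasoning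
  swap : ∀ x x′ y → x + (x′ + y) ≡ x′ + (x + y)
  swap = solve-∀

-- `n ∸ y` also represents -y, and positivity of y keeps it below n.
%-negation : ∀ {x y} n .{{_ : NonZero n}} → 0 < y → y < n → n ∣ x + y → x % n ≡ n ∸ y
%-negation {x} {y} n 0<y y<n n∣x+y = trans
  (%-cong-negation n n∣x+y (divides 1 (trans (m∸n+n≡m (<⇒≤ y<n)) (sym (*-identityˡ n)))))
  (m<n⇒m%n≡m (∸-monoʳ-< 0<y (<⇒≤ y<n)))

-- Size of the squares against the modulus

F-mono-≤ : ∀ {m n} → m ≤ n → F m ≤ F n
F-mono-≤ {m} m≤n with m≤n⇒∃[o]m+o≡n m≤n
... | k , refl = go m k
  where
  F-suc : ∀ n → F n ≤ F (suc n)
  F-suc zero    = z≤n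
  F-suc (suc n) = m≤m+n (F (suc n)) (F n)
  go : ∀ m k → F m ≤ F (m + k)
  go m zero    = ≤-reflexive (cong F (sym (+-identityʳ m)))
  go m (suc k) rewrite +-suc m k = ≤-trans (go m k) (F-suc (m + k))

F>0 : ∀ {n} → 0 < n → 0 < F n
F>0 {suc n} _ = F-suc>0 n

F²>0 : ∀ {n} → 0 < n → 0 < F n ^ 2
F²>0 0<n = ^-monoˡ-< 2 (F>0 0<n)

-- F(2t) = F(t)² + 2F(t)F(t-1), and F(t-1) is positive because t ≥ 2.
F²<F-2* : ∀ {i t} → 2 ≤ t → i ≤ t → F i ^ 2 < F (2 * t)
F²<F-2* {i} {suc s} (s≤s 1≤s) i≤t = begin-strict
  F i ^ 2                    ≤⟨ ^-monoˡ-≤ 2 (F-mono-≤ i≤t) ⟩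
  q ^ 2                      <⟨ m<m+n (q ^ 2) (*-mono-≤ {1} {q} {1} {2 * p} (F-suc>0 s) (≤-trans (F>0 1≤s) (m≤m+n p _))) ⟩
  q ^ 2 + q * (2 * p)        ≡⟨ eq q p ⟩
  (q + p) * q + q * p        ≡⟨ F-+-suc (suc s) s ⟨
  F (suc s + suc s)          ≡⟨ cong (λ z → F (suc s + z)) (+-identityʳ (suc s)) ⟨
  F (2 * suc s)              ∎
  where
  open ≤-Reasoning
  q = F (suc s)
  p = F s
  eq : ∀ q p → q ^ 2 + q * (2 * p) ≡ (q + p) * q + q * p
  eq = solve 2 (λ q p → q :^ 2 :+ q :* (con 2 :* p) := (q :+ p) :* q :+ q :* p) refl

-- F(2t+1) = F(t+1)² + F(t)², which leaves room for the index t + 1.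
F²<F-2*+1 : ∀ {i t} → 0 < t → i ≤ t + 1 → F i ^ 2 < F (2 * t + 1)
F²<F-2*+1 {i} {t} 0<t i≤ = begin-strict
  F i ^ 2                         ≤⟨ ^-monoˡ-≤ 2 (F-mono-≤ i≤) ⟩
  F (t + 1) ^ 2                   ≡⟨ cong (λ z → F z ^ 2) (+-comm t 1) ⟩
  F (suc t) ^ 2                   <⟨ m<m+n (F (suc t) ^ 2) (F²>0 0<t) ⟩
  F (suc t) ^ 2 + F t ^ 2         ≡⟨ eq (F (suc t)) (F t) ⟩
  F (suc t) * F (suc t) + F t * F t ≡⟨ F-+-suc t t ⟨
  F (t + suc t)                   ≡⟨ cong F (ix t) ⟩
  F (2 * t + 1)                   ∎
  where
  open ≤-Reasoning
  eq : ∀ q p → q ^ 2 + p ^ 2 ≡ q * q + p * p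
  eq = solve 2 (λ q p → q :^ 2 :+ p :^ 2 := q :* q :+ p :* p) refl
  ix : ∀ t → t + suc t ≡ 2 * t + 1
  ix = solve-∀

-- Even j

module Even (t : ℕ) .{{_ : NonZero (2 * t)}} (2≤t : 2 ≤ t) where

  j = 2 * t

  low : ∀ i → i ≤ t → ρ i j 2 ≡ F i ^ 2
  low i i≤t = m<n⇒m%n≡m {{F-nonZero j}} (F²<F-2* 2≤t i≤t)

  ρ-reflect : ∀ b a → b ≤ a → b + a ≡ j → ρ a j 2 ≡ ρ b j 2
  ρ-reflect b a b≤a b+a≡j with m≤n⇒∃[o]m+o≡n b≤a
  ... | d , refl = go j b+a≡j (even-2* t) (even-1+2* t)
    where
    -- With `j` a variable, the equation can be matched by `refl`, which `2 * t` would block.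
    go : ∀ j .{{_ : NonZero j}} → b + (b + d) ≡ j → even j ≡ 1 → even (suc j) ≡ 0 →
      ρ (b + d) j 2 ≡ ρ b j 2
    go _ refl = ρ-reflect-even b d

  high : ∀ i → t + 1 ≤ i → i ≤ j ∸ 1 → ρ i j 2 ≡ F (j ∸ i) ^ 2
  high i t<i i<j = trans (ρ-reflect (j ∸ i) i (≤-trans j∸i≤t t≤i) (m∸n+n≡m i≤j)) (low (j ∸ i) j∸i≤t)
    where
    i≤j : i ≤ j
    i≤j = ≤-trans i<j (m∸n≤m j 1)
    t≤i : t ≤ i
    t≤i = ≤-trans (m≤m+n t 1) t<i
    j∸i≤t : j ∸ i ≤ t
    j∸i≤t = m≤n+o⇒m∸n≤o j i (+-mono-≤ t≤i (≤-reflexive (+-identityʳ t)))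

  ρ>0 : ∀ i → 0 < i → i < j → 0 < ρ i j 2
  ρ>0 i 0<i i<j with i ≤? t
  ... | yes i≤t = subst (0 <_) (sym (low i i≤t)) (F²>0 0<i)
  ... | no i≰t  = subst (0 <_) (sym (high i (subst (_≤ i) (+-comm 1 t) (≰⇒> i≰t)) (∸-monoˡ-≤ 1 i<j)))
                    (F²>0 (m<n⇒0<n∸m i<j))

  periodicity : HasPeriodicity (𝓕 2 j) j
  periodicity = (≤-trans (≤-trans (s≤s z≤n) 2≤t) (m≤m+n t _)
                , λ i → ρ-translate-even i j (even-2* t) (even-1+2* t))
              , minimal
    where
    minimal : ∀ q → IsPeriod (𝓕 2 j) q → j ≤ q
    minimal q (0<q , period) with j ≤? q
    ... | yes j≤q = j≤q
    ... | no  j≰q = contradiction (trans (period 0) (low 0 z≤n)) (>⇒≢ (ρ>0 q 0<q (≰⇒> j≰q)))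

-- Odd j

module Odd (t : ℕ) .{{_ : NonZero (2 * t + 1)}} (2≤t : 2 ≤ t) where

  j = 2 * t + 1

  even-j : even j ≡ 0
  even-j = trans (cong even (+-comm (2 * t) 1)) (even-1+2* t)

  even-suc-j : even (suc j) ≡ 1
  even-suc-j = trans (cong (λ z → even (suc z)) (+-comm (2 * t) 1)) (even-2* t)

  0<t : 0 < t
  0<t = ≤-trans (s≤s z≤n) 2≤t

  F∣reflect : ∀ b a → b + a ≡ j → F j ∣ F a ^ 2 + F b ^ 2
  F∣reflect b a b+a≡j = subst (λ z → F z ∣ F a ^ 2 + F b ^ 2) b+a≡j
    (F∣reflect-odd b a (trans (cong even b+a≡j) even-j)
                       (trans (cong (λ z → even (suc z)) b+a≡j) even-suc-j))

  low : ∀ i → i ≤ t + 1 → ρ i j 2 ≡ F i ^ 2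
  low i i≤ = m<n⇒m%n≡m {{F-nonZero j}} (F²<F-2*+1 0<t i≤)

  reflected<F : ∀ i → t + 2 ≤ i → F (j ∸ i) ^ 2 < F j
  reflected<F i t+2≤i = F²<F-2*+1 0<t (m≤n+o⇒m∸n≤o j i (begin
    2 * t + 1          ≡⟨ eq t ⟩
    t + (t + 1)        ≤⟨ +-monoˡ-≤ (t + 1) (≤-trans (m≤m+n t 2) t+2≤i) ⟩
    i + (t + 1)        ∎))
    where
    open ≤-Reasoning
    eq : ∀ t → 2 * t + 1 ≡ t + (t + 1)
    eq = solve-∀

  middle : ∀ i → t + 2 ≤ i → i < j → ρ i j 2 ≡ F j ∸ F (j ∸ i) ^ 2
  middle i t+2≤i i<j = %-negation (F j) {{F-nonZero j}} (F²>0 (m<n⇒0<n∸m i<j)) (reflected<F i t+2≤i)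
    (F∣reflect (j ∸ i) i (m∸n+n≡m (<⇒≤ i<j)))

  ≤j∸1⇒<j : ∀ {i} → i ≤ j ∸ 1 → i < j
  ≤j∸1⇒<j {i} i≤ = subst (i <_) (+-comm 1 (2 * t)) (s≤s (subst (i ≤_) (m+n∸n≡m (2 * t) 1) i≤))

  -- The difference is a genuine one in ℤ; truncated subtraction agrees with it because the
  -- reflected square is below F(j).
  middle-ℤ : ∀ i → t + 2 ≤ i → i ≤ j ∸ 1 → + ρ i j 2 ≡ + F j - + (F (j ∸ i) ^ 2)
  middle-ℤ i t+2≤i i≤ = trans (cong +_ (middle i t+2≤i (≤j∸1⇒<j i≤)))
    (trans (sym (ℤ.⊖-≥ (<⇒≤ (reflected<F i t+2≤i)))) (sym (ℤ.m-n≡m⊖n (F j) (F (j ∸ i) ^ 2))))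

  ρ-self : ρ j j 2 ≡ 0
  ρ-self = n∣m⇒m%n≡0 (F j ^ 2) (F j) {{F-nonZero j}} (m∣m*n (F j ^ 1))

  -- Translating k by j and reflecting k in j both give -F(k)².
  ρ-reflect-2j : ∀ k → k ≤ j → ρ (k + j) j 2 ≡ ρ (j ∸ k) j 2
  ρ-reflect-2j k k≤j = %-cong-negation (F j) {{F-nonZero j}}
    (F∣translate-odd k j even-j even-suc-j) (F∣reflect k (j ∸ k) (m+[n∸m]≡n k≤j))

  high : ∀ i → j ≤ i → i ≤ 2 * j → ρ i j 2 ≡ ρ (2 * j ∸ i) j 2
  high i j≤i i≤2j with m≤n⇒∃[o]m+o≡n j≤i
  ... | k , refl = begin
    ρ (j + k) j 2            ≡⟨ cong (λ z → ρ z j 2) (+-comm j k) ⟩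
    ρ (k + j) j 2            ≡⟨ ρ-reflect-2j k k≤j ⟩
    ρ (j ∸ k) j 2            ≡⟨ cong (λ z → ρ (z ∸ k) j 2) (+-identityʳ j) ⟨
    ρ (j + 0 ∸ k) j 2        ≡⟨ cong (λ z → ρ z j 2) ([m+n]∸[m+o]≡n∸o j (j + 0) k) ⟨
    ρ (2 * j ∸ (j + k)) j 2  ∎
    where
    open ≡-Reasoning
    k≤j : k ≤ j
    k≤j = subst (k ≤_) (+-identityʳ j) (+-cancelˡ-≤ j k (j + 0) i≤2j)

  ρ>0 : ∀ i → 0 < i → i < j → 0 < ρ i j 2
  ρ>0 i 0<i i<j with i ≤? t + 1
  ... | yes i≤ = subst (0 <_) (sym (low i i≤)) (F²>0 0<i)
  ... | no i≰  = subst (0 <_) (sym (middle i t+2≤i i<j)) (m<n⇒0<n∸m (reflected<F i t+2≤i))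
    where
    t+2≤i : t + 2 ≤ i
    t+2≤i = subst (_≤ i) (sym (+-suc t 1)) (≰⇒> i≰)

  -- Two translations by j cancel their signs: both squares are congruent to -F(i+j)².
  periodic : ∀ i → ρ (i + 2 * j) j 2 ≡ ρ i j 2
  periodic i = %-cong-negation (F j) {{F-nonZero j}}
    (subst (λ z → F j ∣ F z ^ 2 + F (i + j) ^ 2) (eq i j) (F∣translate-odd (i + j) j even-j even-suc-j))
    (subst (F j ∣_) (+-comm (F (i + j) ^ 2) (F i ^ 2)) (F∣translate-odd i j even-j even-suc-j))
    where
    eq : ∀ i j → i + j + j ≡ i + 2 * j
    eq = solve-∀

  j-not-period : ρ (1 + j) j 2 ≢ ρ 1 j 2
  j-not-period eq = <⇒≢ 2<F (sym F≡2)
    where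
    1≤t+1 : 1 ≤ t + 1
    1≤t+1 = m≤n+m 1 t
    1<F : 1 < F j
    1<F = F²<F-2*+1 {1} 0<t 1≤t+1
    2<F : 2 < F j
    -- t ≥ 2 gives j ≥ 5, and F(5) = 5. For j = 3 the modulus is 2, where -1 and 1 coincide.
    2<F = ≤-trans (s≤s (s≤s (s≤s z≤n))) (F-mono-≤ {5} (+-monoˡ-≤ 1 (*-monoʳ-≤ 2 2≤t)))
    F∸1≡1 : F j ∸ 1 ≡ 1
    F∸1≡1 = trans (sym (%-negation (F j) {{F-nonZero j}} (s≤s z≤n) 1<F (F∣translate-odd 1 j even-j even-suc-j)))
                  (trans eq (low 1 1≤t+1))
    F≡2 : F j ≡ 2
    F≡2 = trans (sym (m+[n∸m]≡n (<⇒≤ 1<F))) (cong suc F∸1≡1)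

  periodicity : HasPeriodicity (𝓕 2 j) (2 * j)
  periodicity = (≤-trans (m≤n+m 1 (2 * t)) (m≤m+n j _) , periodic) , minimal
    where
    minimal : ∀ q → IsPeriod (𝓕 2 j) q → 2 * j ≤ q
    minimal q (0<q , period) with 2 * j ≤? q
    ... | yes 2j≤q = 2j≤q
    ... | no  2j≰q with <-cmp q j
    ...   | tri< q<j _ _    = contradiction (trans (period 0) (low 0 z≤n)) (>⇒≢ (ρ>0 q 0<q q<j))
    -- Index 0 cannot refute q = j, since the residue at j is 0 too; index 1 does.
    ...   | tri≈ _ refl _   = contradiction (period 1) j-not-period
    -- Reflection sends q to 2j - q, strictly between 0 and j, where no residue vanishes.
    ...   | tri> _ _ j<q    = contradiction
      (trans (sym (high q (<⇒≤ j<q) (<⇒≤ q<2j))) (trans (period 0) (low 0 z≤n)))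
      (>⇒≢ (ρ>0 (2 * j ∸ q) (m<n⇒0<n∸m q<2j) 2j∸q<j))
      where
      q<2j : q < 2 * j
      q<2j = ≰⇒> 2j≰q
      2j∸q<j : 2 * j ∸ q < j
      2j∸q<j = subst (2 * j ∸ q <_) (trans (m+n∸m≡n j (j + 0)) (+-identityʳ j)) (∸-monoʳ-< j<q (<⇒≤ q<2j))

theorem3 : (j t : ℕ) .{{_ : NonZero j}} → 4 ≤ j →
    (j ≡ 2 * t →
    HasPeriodicity (𝓕 2 j) j
    × (∀ i → i ≤ t → ρ i j 2 ≡ F i ^ 2)
    × (∀ i → t + 1 ≤ i → i ≤ j ∸ 1 → ρ i j 2 ≡ F (j ∸ i) ^ 2))
    × (j ≡ 2 * t + 1 →
    HasPeriodicity (𝓕 2 j) (2 * j)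
    × (∀ i → i ≤ t + 1 → ρ i j 2 ≡ F i ^ 2)
    × (∀ i → t + 2 ≤ i → i ≤ j ∸ 1 → + ρ i j 2 ≡ + F j - + (F (j ∸ i) ^ 2))
    × (∀ i → i ≡ j → ρ i j 2 ≡ 0)
    × (∀ i → j + 1 ≤ i → i ≤ 2 * j ∸ 1 → ρ i j 2 ≡ ρ (2 * j ∸ i) j 2))
theorem3 j t 4≤j = even-case , odd-case
  where
  even-case : j ≡ 2 * t → _
  even-case refl = E.periodicity , E.low , E.high
    where module E = Even t (*-cancelˡ-≤ {2} {t} 2 4≤j)
  odd-case : j ≡ 2 * t + 1 → _
  odd-case refl =
    O.periodicity , O.low , O.middle-ℤ , (λ { _ refl → O.ρ-self })
    , λ i j<i i<2j → O.high i (≤-trans (m≤m+n j 1) j<i) (≤-trans i<2j (m∸n≤m (2 * j) 1))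
    where
    2≤t : 2 ≤ t
    -- 4 ≤ 2t + 1 yields 2 · 1 < 2t, hence 1 < t.
    2≤t = *-cancelˡ-< 2 1 t (s≤s⁻¹ (subst (4 ≤_) (+-comm (2 * t) 1) 4≤j))
    module O = Odd t 2≤t
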